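{- There exist a finite process set $\mathcal P$ and a local formula $\alpha$ of IPDL over $\mathcal P$ such that there is no CFM $\mathcal A$ (with $k=0$ labeling bits) whose language $L(\mathcal A)$ equals the set of MSCs $M$ with $M\models\mathsf A\alpha$ (i.e., $M,v\models\alpha$ for all nodes $v$).
   Context: For a finite set $\mathcal P$ of processes: channels $\mathrm{Ch}=\{(p,q)\in\mathcal P^2:p\ne q\}$, $\Sigma_p=\{p!q,p?q:q\ne p\}$, $\Sigma=\bigcup_p\Sigma_p$. For a $\Sigma$-labeled poset $(V,\le,\lambda)$, $P(v)=p$ iff $\lambda(v)\in\Sigma_p$, $V_p=P^{ -1}(p)$; $(v,v')\in\mathrm{proc}$ iff $P(v)=P(v')$, $v<v'$ with no node of that process strictly between; $(v,v')\in\mathrm{msg}$ iff for some $(p,q)\in\mathrm{Ch}$, $\lambda(v)=p!q$, $\lambda(v')=q?p$ and $|\{u\le v:\lambda(u)=p!q\}|=|\{u\le v':\lambda(u)=q?p\}|$. An MSC is such a structure with $\le=(\mathrm{proc}\cup\mathrm{msg})^*$, all down-sets finite, each $V_p$ linearly ordered, and $|\lambda^{ -1}(p!q)|=|\lambda^{ -1}(q?p)|$ for all channels. A CFM is $\mathcal A=(C,k,(\mathcal A_p)_p,F)$ with finite message set $C$, $\mathcal A_p=(S_p,\to_p,\iota_p)$ ($S_p$ finite, $\to_p\subseteq S_p\times(\Sigma_p\times\{0,1\}^k\times C)\times S_p$), $F\subseteq\prod_pS_p$. A run on $(M,c)$, $c:V\to\{0,1\}^k$, is $(\rho,\mu)$,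 $\rho:V\to\bigcup_pS_p$, $\mu:V\to C$, with $\mu(v)=\mu(\mathrm{msg}(v))$ when defined and $(\rho(\mathrm{proc}^{ -1}(v)),\lambda(v),c(v),\mu(v),\rho(v))\in\to_{P(v)}$ (with $\iota_{P(v)}$ in place of $\rho(\mathrm{proc}^{ -1}(v))$ if $v$ is minimal on its process); it is accepting if some $(s_p)\in F$ has $s_p\in\{s:\forall v\in V_p\exists v'\in V_p,v\le v',\rho(v')=s\}$ for all $p$. $L(\mathcal A)$ is the set of accepted inputs. IPDL: path expressions $\pi::=\mathrm{proc}\mid\mathrm{msg}\mid\{\alpha\}\mid\pi;\pi\mid\pi+\pi\mid\pi^*$ and local formulas $\alpha::=\mathrm{true}\mid\sigma\ (\sigma\in\Sigma)\mid\alpha\lor\alpha\mid\neg\alpha\mid\langle\pi\rangle\alpha\mid\langle\pi\rangle^{ -1}\alpha\mid\langle\pi_1\cap\pi_2\rangle\alpha$. For an MSC $M$ define relations $R_\pi\subseteq V\times V$: $R_{\mathrm{proc}}=\mathrm{proc}$, $R_{\mathrm{msg}}=\mathrm{msg}$, $R_{\{\alpha\}}=\{(v,v):M,v\models\alpha\}$, $R_{\pi_1;\pi_2}=R_{\pi_1}\circ R_{\pi_2}$ (first $R_{\pi_1}$ then $R_{\pi_2}$), $R_{\pi_1+\pi_2}=R_{\pi_1}\cup R_{\pi_2}$, $R_{\pi^*}$ = reflexive-transitive closure of $R_\pi$. Then $M,v\models\sigma$ iff $\lambda(v)=\sigma$; Booleans as usual; $M,v\models\langle\pi\rangle\alpha$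 iff some $w$ with $(v,w)\in R_\pi$ satisfies $\alpha$; $M,v\models\langle\pi_1\cap\pi_2\rangle\alpha$ iff some $w$ with $(v,w)\in R_{\pi_1}\cap R_{\pi_2}$ satisfies $\alpha$; $\langle\pi\rangle^{ -1}$ is the backward modality: $\langle\mathrm{proc}\rangle^{ -1}\alpha$ (resp. $\langle\mathrm{msg}\rangle^{ -1}\alpha$) holds at $v$ iff some $v'$ with $(v',v)\in\mathrm{proc}$ (resp. $\mathrm{msg}$) satisfies $\alpha$, $\langle\{\alpha\}\rangle^{ -1}\beta\equiv\alpha\land\beta$, $\langle\pi_1;\pi_2\rangle^{ -1}\alpha\equiv\langle\pi_1\rangle^{ -1}\langle\pi_2\rangle^{ -1}\alpha$, $\langle\pi_1+\pi_2\rangle^{ -1}\alpha\equiv\langle\pi_1\rangle^{ -1}\alpha\lor\langle\pi_2\rangle^{ -1}\alpha$, $\langle\pi^*\rangle^{ -1}\alpha$ iff $(\langle\pi\rangle^{ -1})^j\alpha$ for some $j\ge0$. -}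

module Defs where

open import Data.Nat using (ℕ; zero; suc)
open import Data.Fin using (Fin)
open import Data.List using (List)
open import Data.List.Membership.Propositional using (_∈_)
open import Data.Product using (Σ; ∃; ∃-syntax; _×_; _,_)
open import Data.Sum using (_⊎_)
open import Data.Unit using (⊤)
open import Relation.Nullary using (¬_)
open import Relation.Binary.PropositionalEquality using (_≡_; _≢_; sym; subst)
open import Relation.Binary.Structures using (IsPartialOrder)
open import Relation.Binary.Construct.Closure.ReflexiveTransitive using (Star)
open import Function.Bundles using (_↔_)
open import Function.Definitions using (Injective)

-- Processes: Fin n.  Actions Σ = { p!q , p?q : q ≠ p }.
-- act snd p q _  is  p!q   and   act rcv p q _  is  p?q ; both lie in Σ_p.

data Dir : Set where
  snd rcv : Dir

record Act (n : ℕ) : Set where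
  constructor act
  field
    dir      : Dir
    me       : Fin n
    other    : Fin n
    .distinct : me ≢ other
open Act public

dual : ∀ {n} → Act n → Act n
dual (act snd p q ne) = act rcv q p (λ e → ne (sym e))
dual (act rcv p q ne) = act snd q p (λ e → ne (sym e))

module Struct {n : ℕ} (V : Set) (_≤_ : V → V → Set) (lab : V → Act n) where

  P : V → Fin n
  P v = me (lab v)

  _<_ : V → V → Set
  u < v = u ≤ v × u ≢ v

  record Proc (u v : V) : Set where
    field
      sameP     : P u ≡ P v
      lt        : u < v
      noBetween : ∀ w → P w ≡ P u → ¬ (u < w × w < v)

  HasSize : (V → Set) → ℕ → Set
  HasSize A k = Σ (Fin k → V) λ f →
    Injective _≡_ _≡_ f × (∀ u → (A u → ∃[ i ] f i ≡ u) × (∃[ i ] f i ≡ u → A u))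

  Msg : V → V → Set
  Msg u v = dir (lab u) ≡ snd × dir (lab v) ≡ rcv
          × me (lab u) ≡ other (lab v) × other (lab u) ≡ me (lab v)
          × ∃[ k ] (HasSize (λ w → w ≤ u × lab w ≡ lab u) k
                   × HasSize (λ w → w ≤ v × lab w ≡ lab v) k)

  Step : V → V → Set
  Step u v = Proc u v ⊎ Msg u v

record MSC (n : ℕ) : Set₁ where
  field
    V    : Set
    _≤_  : V → V → Set
    lab  : V → Act n
  open Struct V _≤_ lab public
  field
    isPO       : IsPartialOrder _≡_ _≤_
    ≤-generated : ∀ u v → (u ≤ v → Star Step u v) × (Star Step u v → u ≤ v)
    downFinite : ∀ v → ∃[ xs ] (∀ u → u ≤ v → u ∈ xs)
    procLinear : ∀ u v → P u ≡ P v → (u ≤ v) ⊎ (v ≤ u)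
    balanced   : ∀ (a : Act n) → dir a ≡ snd →
                 (Σ V λ v → lab v ≡ a) ↔ (Σ V λ v → lab v ≡ dual a)

mutual
  data Path (n : ℕ) : Set where
    proc  : Path n
    msg   : Path n
    test  : Form n → Path n
    _⨾_   : Path n → Path n → Path n
    _⊕_   : Path n → Path n → Path n
    _⋆    : Path n → Path n

  data Form (n : ℕ) : Set where
    true   : Form n
    atom   : Act n → Form n
    _∨_    : Form n → Form n → Form n
    neg    : Form n → Form n
    ⟨_⟩_   : Path n → Form n → Form n
    ⟨_⟩⁻¹_ : Path n → Form n → Form n
    ⟨_∩_⟩_ : Path n → Path n → Form n → Form n

module Semantics {n : ℕ} (M : MSC n) where
  open MSC M

  mutual
    Sat : Form n → V → Set
    Sat true v = ⊤
    Sat (atom σ) v = lab v ≡ σ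
    Sat (α ∨ β) v = Sat α v ⊎ Sat β v
    Sat (neg α) v = ¬ Sat α v
    Sat (⟨ π ⟩ α) v = ∃[ w ] (Rel π v w × Sat α w)
    Sat (⟨ π ⟩⁻¹ α) v = Back π (Sat α) v
    Sat (⟨ π₁ ∩ π₂ ⟩ α) v = ∃[ w ] (Rel π₁ v w × Rel π₂ v w × Sat α w)

    Rel : Path n → V → V → Set
    Rel proc u v = Proc u v
    Rel msg u v = Msg u v
    Rel (test α) u v = u ≡ v × Sat α u
    Rel (π₁ ⨾ π₂) u v = ∃[ w ] (Rel π₁ u w × Rel π₂ w v)
    Rel (π₁ ⊕ π₂) u v = Rel π₁ u v ⊎ Rel π₂ u v
    Rel (π ⋆) u v = Star (Rel π) u v

    Back : Path n → (V → Set) → V → Set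
    Back proc A v = ∃[ u ] (Proc u v × A u)
    Back msg A v = ∃[ u ] (Msg u v × A u)
    Back (test α) A v = Sat α v × A v
    Back (π₁ ⨾ π₂) A v = Back π₁ (Back π₂ A) v
    Back (π₁ ⊕ π₂) A v = Back π₁ A v ⊎ Back π₂ A v
    Back (π ⋆) A v = ∃[ j ] BackIter π j A v

    BackIter : Path n → ℕ → (V → Set) → V → Set
    BackIter π zero A v = A v
    BackIter π (suc j) A v = Back π (BackIter π j A) v

  Models : Form n → Set
  Models α = ∀ v → Sat α v

-- Communicating finite-state machines with k = 0 labelling bits
-- (the bit component {0,1}^0 is a singleton and is omitted).

record CFM (n : ℕ) : Set₁ where
  field
    nMsg  : ℕ
    nSt   : Fin n → ℕ
    trans : (p : Fin n) → Fin (nSt p) → Act n → Fin nMsg → Fin (nSt p) → Set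
    init  : (p : Fin n) → Fin (nSt p)
    Final : ((p : Fin n) → Fin (nSt p)) → Set

module Runs {n : ℕ} (A : CFM n) (M : MSC n) where
  open CFM A
  open MSC M

  S : Fin n → Set
  S p = Fin (nSt p)

  record Run : Set where
    field
      ρ      : (v : V) → S (P v)
      μ      : V → Fin nMsg
      msgOk  : ∀ u v → Msg u v → μ u ≡ μ v
      initOk : ∀ v → (∀ u → P u ≡ P v → ¬ (u < v)) →
               trans (P v) (init (P v)) (lab v) (μ v) (ρ v)
      stepOk : ∀ u v → (h : Proc u v) →
               trans (P v) (subst S (Proc.sameP h) (ρ u)) (lab v) (μ v) (ρ v)

  Cofinal : Run → (p : Fin n) → S p → Set
  Cofinal r p s = ∀ v → P v ≡ p →
    ∃[ v' ] (v ≤ v' × Σ (P v' ≡ p) λ e → subst S e (Run.ρ r v') ≡ s)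

  Accepting : Run → Set
  Accepting r = ∃[ f ] (Final f × (∀ p → Cofinal r p (f p)))

Accepts : ∀ {n} → CFM n → MSC n → Set
Accepts A M = ∃[ r ] Runs.Accepting A M r

{-# OPTIONS --safe #-}

-- An infinite word b and a lag n ≥ 1 are encoded by a spiral.  At each step t, process 0 receives a
-- message from process 1 and then sends one message to process 1 and one to process 2, in an order
-- that encodes b t.  Process 1 starts with n messages of its own and then answers one by one, so
-- that the answer to step t opens step t + n.  A round trip thus advances by n steps, and a round
-- trip followed by a full step of process 0 advances by n + 1: the intersection of the iterations
-- of these two paths relates exactly the steps that differ by a multiple of n (n + 1), and an IPDL
-- formula can say that b does not drop from 1 to 0 at such distances.  Words of period n (n + 1)
-- satisfy it, so a CFM for it accepts their spirals.  But between two consecutive steps a run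
-- carries only three local states and n pending messages, which for large n allows fewer than
-- 2 ^ (n (n + 1)) configurations.  Two distinct such words therefore share one, and switching after
-- one period from one word to the other is accepted as well; in one of the two directions it
-- drops from 1 to 0.
module Submission where

open import Defs
open import Data.Bool.Base using (Bool; true; false; not; if_then_else_)
open import Data.Empty using (⊥)
open import Data.Fin.Base as Fin using (Fin; toℕ; fromℕ<)
open import Data.Fin.Patterns using (0F; 1F; 2F)
open import Data.Fin.Properties using
  (toℕ-injective; toℕ<n; toℕ-fromℕ<; fromℕ<-cong; injective⇒≤; pigeonhole; combine-injective;
   finToFun-funToFin; funToFin-finToFin; ¬∀⟶∃¬)
  renaming (_≟_ to _≟ᶠ_; <⇒≢ to <⇒≢ᶠ)
open import Data.List.Base using (List; _++_; map; upTo)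
open import Data.List.Membership.Propositional using (_∈_)
open import Data.List.Membership.Propositional.Properties using (∈-++⁺ˡ; ∈-++⁺ʳ; ∈-map⁺; ∈-upTo⁺)
open import Data.Nat.Base
open import Data.Nat.DivMod using (_mod_; [m+kn]%n≡m%n; m<n⇒m%n≡m)
open import Data.Nat.Divisibility using (_∣_; divides; ∣m+n∣m⇒∣n; n∣m*n)
open import Data.Nat.Properties
open import Data.Nat.Tactic.RingSolver using (solve-∀)
open import Data.Product.Base using (Σ; ∃-syntax; _×_; _,_; proj₁; proj₂)
open import Data.Sum.Base using (_⊎_; inj₁; inj₂)
open import Function.Base using (_∘_; case_of_)
open import Function.Bundles using (_↔_; mk↔ₛ′)
open import Function.Definitions using (Injective)
open import Relation.Binary.Construct.Closure.ReflexiveTransitive using (Star; ε; _◅_; _◅◅_; gmap; concat)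
open import Relation.Binary.PropositionalEquality
open import Relation.Binary.Structures using (IsPartialOrder)
open import Relation.Nullary using (¬_; yes; no; contradiction)

-- Comparison of times written as a phase plus six times a step

scaled-<⁻¹ : ∀ {c d} a b → d ≤ c → c + a * 6 < d + b * 6 → a < b
scaled-<⁻¹ {c} {d} a b d≤c lt with a <? b
... | yes a<b = a<b
... | no  a≮b = contradiction lt (≤⇒≯ (+-mono-≤ d≤c (*-monoˡ-≤ 6 (≮⇒≥ a≮b))))

scaled-< : ∀ {c} d {a b} → c < 6 → a < b → c + a * 6 < d + b * 6
scaled-< {c} d {a} {b} c<6 a<b = begin-strict
  c + a * 6   <⟨ +-monoˡ-< (a * 6) c<6 ⟩
  suc a * 6   ≤⟨ *-monoˡ-≤ 6 a<b ⟩
  b * 6       ≤⟨ m≤n+m (b * 6) d ⟩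
  d + b * 6   ∎
  where open ≤-Reasoning

-- Events of the spiral and their actions

-- The argument t of relayIn, first, second and sink is the step of process 0 at which the message
-- was sent; recv t and relayOut t are the two ends of the message that starts step t.
data Event : Set where
  recv first second relayIn relayOut sink : ℕ → Event

index : Event → ℕ
index (recv t)     = t
index (first t)    = t
index (second t)   = t
index (relayIn t)  = t
index (relayOut t) = t
index (sink t)     = t

process : Event → Fin 3
process (recv _)     = 0F
process (first _)    = 0F
process (second _)   = 0F
process (relayIn _)  = 1F
process (relayOut _) = 1F
process (sink _)     = 2F

direction : Event → Dir
direction (recv _)     = rcv
direction (first _)    = snd
direction (second _)   = snd
direction (relayIn _)  = rcv
direction (relayOut _) = snd
direction (sink _)     = rcv

-- The Boolean of `out` and `arrive` names the channel: `true` leads from process 0 to process 1,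
-- `false` from process 0 to process 2. Kinds make actions comparable by pattern matching, free of
-- the proofs of distinctness.
data Kind : Set where
  out      : Bool → Kind
  arrive   : Bool → Kind
  back     : Kind
  feedback : Kind

dualKind : Kind → Kind
dualKind (out x)    = arrive x
dualKind (arrive x) = out x
dualKind back       = feedback
dualKind feedback   = back

dualKind-involutive : ∀ k → dualKind (dualKind k) ≡ k
dualKind-involutive (out x)    = refl
dualKind-involutive (arrive x) = refl
dualKind-involutive back       = refl
dualKind-involutive feedback   = refl

action : Kind → Act 3
action (out true)     = act snd 0F 1F (λ ())
action (out false)    = act snd 0F 2F (λ ())
action (arrive true)  = act rcv 1F 0F (λ ())
action (arrive false) = act rcv 2F 0F (λ ())
action back           = act snd 1F 0F (λ ())
action feedback       = act rcv 0F 1F (λ ())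

-- A left inverse of `action`, from which its injectivity follows. Actions that occur in no spiral,
-- such as a send from process 1 to process 2, get arbitrary kinds.
actionKind : Act 3 → Kind
actionKind (act snd 0F 1F _) = out true
actionKind (act snd 0F _  _) = out false
actionKind (act snd _  _  _) = back
actionKind (act rcv 0F _  _) = feedback
actionKind (act rcv 1F _  _) = arrive true
actionKind (act rcv _  _  _) = arrive false

actionKind-action : ∀ k → actionKind (action k) ≡ k
actionKind-action (out true)     = refl
actionKind-action (out false)    = refl
actionKind-action (arrive true)  = refl
actionKind-action (arrive false) = refl
actionKind-action back           = refl
actionKind-action feedback       = refl

action-injective : ∀ {k k′} → action k ≡ action k′ → k ≡ k′
action-injective {k} {k′} eq =
  trans (sym (actionKind-action k)) (trans (cong actionKind eq) (actionKind-action k′))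

action-dual : ∀ k → action (dualKind k) ≡ dual (action k)
action-dual (out true)     = refl
action-dual (out false)    = refl
action-dual (arrive true)  = refl
action-dual (arrive false) = refl
action-dual back           = refl
action-dual feedback       = refl

-- General facts on dual actions, transport and sizes

dual-involutive : ∀ {n} (a : Act n) → dual (dual a) ≡ a
dual-involutive (act snd _ _ _) = refl
dual-involutive (act rcv _ _ _) = refl

dual-receives : ∀ {n} (a : Act n) → dir a ≡ snd → dir (dual a) ≡ rcv
dual-receives (act snd _ _ _) refl = refl

dual-me : ∀ {n} (a : Act n) → me (dual a) ≡ other a
dual-me (act snd _ _ _) = refl
dual-me (act rcv _ _ _) = refl

dual-other : ∀ {n} (a : Act n) → other (dual a) ≡ me a
dual-other (act snd _ _ _) = refl
dual-other (act rcv _ _ _) = refl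

-- These hypotheses are the conditions of `Msg` apart from the counting. Distinctness is irrelevant
-- in `Act`, so equal components already give equal actions.
matching-dual : ∀ {n} {a b : Act n} → dir a ≡ snd → dir b ≡ rcv →
                me a ≡ other b → other a ≡ me b → b ≡ dual a
matching-dual {a = act snd _ _ _} {act rcv _ _ _} refl refl refl refl = refl

subst-irrelevant : ∀ {A : Set} (B : A → Set) {p q : A} (e e′ : p ≡ q) {x y : B p} →
                   x ≡ y → subst B e x ≡ subst B e′ y
subst-irrelevant B refl refl refl = refl

module _ {n : ℕ} {V : Set} (_≤ᵥ_ : V → V → Set) (lab : V → Act n) where
  open Struct V _≤ᵥ_ lab

  -- Sending an index of the first enumeration to an index of the same element in the second is
  -- injective.
  HasSize-≤ : ∀ {A k k′} → HasSize A k → HasSize A k′ → k ≤ k′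
  HasSize-≤ (f , f-inj , f-img) (g , _ , g-img) = injective⇒≤ {f = proj₁ ∘ preimage} λ {i} {j} eq →
    f-inj (trans (sym (proj₂ (preimage i))) (trans (cong g eq) (proj₂ (preimage j))))
    where
    preimage : ∀ i → ∃[ j ] g j ≡ f i
    preimage i = proj₁ (g-img (f i)) (proj₂ (f-img (f i)) (i , refl))

  HasSize-unique : ∀ {A k k′} → HasSize A k → HasSize A k′ → k ≡ k′
  HasSize-unique s s′ = ≤-antisym (HasSize-≤ s s′) (HasSize-≤ s′ s)

-- Times and process successors in the spiral with lag `n`

module Spiral (n : ℕ) .{{_ : NonZero n}} where

  -- time is a linearisation of the order in which the relay acts as late as possible, namely just
  -- before the step that waits for it.
  phase : Event → ℕ
  phase (relayIn _)  = 0
  phase (relayOut _) = 1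
  phase (recv _)     = 2
  phase (first _)    = 3
  phase (second _)   = 4
  phase (sink _)     = 5

  -- A message sent to process 1 in step `t` is received just before step `t + n`, which its answer
  -- opens. The later surgery cuts the spiral along this function.
  step : Event → ℕ
  step (relayIn t)  = t + n
  step v            = index v

  time : Event → ℕ
  time v = phase v + step v * 6

  phase<6 : ∀ v → phase v < 6
  phase<6 (relayIn _)  = s≤s z≤n
  phase<6 (relayOut _) = s≤s (s≤s z≤n)
  phase<6 (recv _)     = s≤s (s≤s (s≤s z≤n))
  phase<6 (first _)    = s≤s (s≤s (s≤s (s≤s z≤n)))
  phase<6 (second _)   = s≤s (s≤s (s≤s (s≤s (s≤s z≤n))))
  phase<6 (sink _)     = ≤-refl

  step<⇒time< : ∀ {u v} → step u < step v → time u < time v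
  step<⇒time< {u} {v} = scaled-< (phase v) (phase<6 u)

  time≤⇒step≤ : ∀ {u v} → time u ≤ time v → step u ≤ step v
  time≤⇒step≤ {u} {v} le with step u ≤? step v
  ... | yes p = p
  ... | no ¬p = contradiction le (<⇒≱ (step<⇒time< {v} {u} (≰⇒> ¬p)))

  -- The phase is the time modulo 6, the step is the quotient, and `eventAt` rebuilds the event from
  -- both.
  time-injective : Injective _≡_ _≡_ time
  time-injective {u} {v} eq = begin
    u                          ≡⟨ event-at u ⟨
    eventAt (phase u) (step u) ≡⟨ cong₂ eventAt phase≡ step≡ ⟩
    eventAt (phase v) (step v) ≡⟨ event-at v ⟩
    v                          ∎
    where
    open ≡-Reasoning
    eventAt : ℕ → ℕ → Event
    eventAt 0 s = relayIn (s ∸ n)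
    eventAt 1 s = relayOut s
    eventAt 2 s = recv s
    eventAt 3 s = first s
    eventAt 4 s = second s
    eventAt _ s = sink s

    event-at : ∀ v → eventAt (phase v) (step v) ≡ v
    event-at (relayIn t)  = cong relayIn (m+n∸n≡m t n)
    event-at (relayOut t) = refl
    event-at (recv t)     = refl
    event-at (first t)    = refl
    event-at (second t)   = refl
    event-at (sink t)     = refl

    phase%6 : ∀ v → phase v % 6 ≡ phase v
    phase%6 (relayIn _)  = refl
    phase%6 (relayOut _) = refl
    phase%6 (recv _)     = refl
    phase%6 (first _)    = refl
    phase%6 (second _)   = refl
    phase%6 (sink _)     = refl

    time%6 : ∀ v → time v % 6 ≡ phase v
    time%6 v = trans ([m+kn]%n≡m%n (phase v) (step v) 6) (phase%6 v)

    phase≡ : phase u ≡ phase v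
    phase≡ = trans (sym (time%6 u)) (trans (cong (_% 6) eq) (time%6 v))

    step≡ : step u ≡ step v
    step≡ = *-cancelʳ-≡ (step u) (step v) 6
      (+-cancelˡ-≡ (phase u) _ _ (trans eq (cong (_+ step v * 6) (sym phase≡))))

  -- Process 1 first performs `relayOut 0` to `relayOut (n - 1)` with no receipt in between. From
  -- then on receipts and answers alternate, starting with `relayIn 0` and `relayOut n`; the case
  -- split on `n ≤? suc t` separates the two regimes.
  succ : Event → Event
  succ (recv t)     = first t
  succ (first t)    = second t
  succ (second t)   = recv (suc t)
  succ (relayIn t)  = relayOut (t + n)
  succ (relayOut t) with n ≤? suc t
  ... | yes _ = relayIn (suc t ∸ n)
  ... | no  _ = relayOut (suc t)
  succ (sink t)     = sink (suc t)

  process-succ : ∀ u → process (succ u) ≡ process u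
  process-succ (recv t)     = refl
  process-succ (first t)    = refl
  process-succ (second t)   = refl
  process-succ (relayIn t)  = refl
  process-succ (relayOut t) with n ≤? suc t
  ... | yes _ = refl
  ... | no  _ = refl
  process-succ (sink t)     = refl

  time-succ : ∀ u → time u < time (succ u)
  time-succ (recv t)     = ≤-refl
  time-succ (first t)    = ≤-refl
  time-succ (second t)   = step<⇒time< {second t} {recv (suc t)} ≤-refl
  time-succ (relayIn t)  = ≤-refl
  time-succ (relayOut t) with n ≤? suc t
  ... | yes n≤ = step<⇒time< {relayOut t} {relayIn (suc t ∸ n)} (≤-reflexive (sym (m∸n+n≡m n≤)))
  ... | no  _  = step<⇒time< {relayOut t} {relayOut (suc t)} ≤-refl
  time-succ (sink t)     = step<⇒time< {sink t} {sink (suc t)} ≤-refl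

  -- Together with `time-succ`, this makes `succ u` the immediate successor of `u` on its process.
  -- Where the successor lies in a later step, a larger time at no larger phase forces a larger
  -- step.
  succ-least : ∀ u w → process u ≡ process w → time u < time w → time (succ u) ≤ time w
  succ-least (recv t) w p lt = lt
  succ-least (first t) w p lt = lt
  succ-least (relayIn t) w p lt = lt
  succ-least (second t) (recv s) p lt = +-monoʳ-≤ 2 (*-monoˡ-≤ 6 (scaled-<⁻¹ {4} {2} t s (s≤s (s≤s z≤n)) lt))
  succ-least (second t) (first s) p lt =
    +-mono-≤ {2} {3} (s≤s (s≤s z≤n)) (*-monoˡ-≤ 6 (scaled-<⁻¹ {4} {3} t s (s≤s (s≤s (s≤s z≤n))) lt))
  succ-least (second t) (second s) p lt =
    +-mono-≤ {2} {4} (s≤s (s≤s z≤n)) (*-monoˡ-≤ 6 (scaled-<⁻¹ {4} {4} t s ≤-refl lt))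
  succ-least (sink t) (sink s) p lt = +-monoʳ-≤ 5 (*-monoˡ-≤ 6 (scaled-<⁻¹ {5} {5} t s ≤-refl lt))
  succ-least (relayOut t) w p lt with n ≤? suc t
  succ-least (relayOut t) (relayIn s)  p lt | yes n≤ =
    *-monoˡ-≤ 6 (subst (_≤ s + n) (sym (m∸n+n≡m n≤)) (scaled-<⁻¹ {1} {0} t (s + n) z≤n lt))
  succ-least (relayOut t) (relayOut s) p lt | yes n≤ =
    +-mono-≤ {0} {1} z≤n
      (*-monoˡ-≤ 6 (subst (_≤ s) (sym (m∸n+n≡m n≤)) (scaled-<⁻¹ {1} {1} t s ≤-refl lt)))
  succ-least (relayOut t) (relayIn s)  p lt | no n≰ =
    <⇒≤ (step<⇒time< {relayOut (suc t)} {relayIn s} (<-≤-trans (≰⇒> n≰) (m≤n+m n s)))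
  succ-least (relayOut t) (relayOut s) p lt | no n≰ =
    +-monoʳ-≤ 1 (*-monoˡ-≤ 6 (scaled-<⁻¹ {1} {1} t s ≤-refl lt))

  index≤time : ∀ v → index v ≤ time v
  index≤time v = ≤-trans (index≤step v) (≤-trans (m≤m*n (step v) 6) (m≤n+m (step v * 6) (phase v)))
    where
    index≤step : ∀ v → index v ≤ step v
    index≤step (relayIn t)  = m≤m+n t n
    index≤step (relayOut t) = ≤-refl
    index≤step (recv t)     = ≤-refl
    index≤step (first t)    = ≤-refl
    index≤step (second t)   = ≤-refl
    index≤step (sink t)     = ≤-refl

  eventsUpTo : ℕ → List Event
  eventsUpTo N = map recv ts ++ map first ts ++ map second ts
              ++ map relayIn ts ++ map relayOut ts ++ map sink ts
    where ts = upTo (suc N)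

  ∈-eventsUpTo : ∀ {N} v → index v ≤ N → v ∈ eventsUpTo N
  ∈-eventsUpTo {N} v le = go v (∈-upTo⁺ (s≤s le))
    where
    ts = upTo (suc N)
    go : ∀ v → index v ∈ ts → v ∈ eventsUpTo N
    go (recv t)     i = ∈-++⁺ˡ (∈-map⁺ recv i)
    go (first t)    i = ∈-++⁺ʳ (map recv ts) (∈-++⁺ˡ (∈-map⁺ first i))
    go (second t)   i = ∈-++⁺ʳ (map recv ts) (∈-++⁺ʳ (map first ts) (∈-++⁺ˡ (∈-map⁺ second i)))
    go (relayIn t)  i = ∈-++⁺ʳ (map recv ts) (∈-++⁺ʳ (map first ts) (∈-++⁺ʳ (map second ts)
                          (∈-++⁺ˡ (∈-map⁺ relayIn i))))
    go (relayOut t) i = ∈-++⁺ʳ (map recv ts) (∈-++⁺ʳ (map first ts) (∈-++⁺ʳ (map second ts)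
                          (∈-++⁺ʳ (map relayIn ts) (∈-++⁺ˡ (∈-map⁺ relayOut i)))))
    go (sink t)     i = ∈-++⁺ʳ (map recv ts) (∈-++⁺ʳ (map first ts) (∈-++⁺ʳ (map second ts)
                          (∈-++⁺ʳ (map relayIn ts) (∈-++⁺ʳ (map relayOut ts) (∈-map⁺ sink i)))))

  -- Labels and messages of the spiral of a word

  module Word (b : ℕ → Bool) where

    kind : Event → Kind
    kind (recv t)     = feedback
    kind (first t)    = out (b t)
    kind (second t)   = out (not (b t))
    kind (relayIn t)  = arrive true
    kind (relayOut t) = back
    kind (sink t)     = arrive false

    -- The occurrence number `t`, counted from 0, of a kind. Kind and index thus serve as
    -- coordinates of events, with the word deciding which of `first` and `second` uses which
    -- channel.
    event : Kind → ℕ → Event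
    event (out true)     t = if b t then first t else second t
    event (out false)    t = if b t then second t else first t
    event (arrive true)  t = relayIn t
    event (arrive false) t = sink t
    event back           t = relayOut t
    event feedback       t = recv t

    kind-event : ∀ k t → kind (event k t) ≡ k
    kind-event (out true)     t with b t in eq
    ... | true  = cong out eq
    ... | false = cong (out ∘ not) eq
    kind-event (out false)    t with b t in eq
    ... | true  = cong (out ∘ not) eq
    ... | false = cong out eq
    kind-event (arrive true)  t = refl
    kind-event (arrive false) t = refl
    kind-event back           t = refl
    kind-event feedback       t = refl

    index-event : ∀ k t → index (event k t) ≡ t
    index-event (out true)     t with b t
    ... | true  = refl
    ... | false = refl
    index-event (out false)    t with b t
    ... | true  = refl
    ... | false = refl
    index-event (arrive true)  t = refl
    index-event (arrive false) t = refl
    index-event back           t = refl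
    index-event feedback       t = refl

    event-kind : ∀ v → event (kind v) (index v) ≡ v
    event-kind (recv t)     = refl
    event-kind (first t)    with b t in eq
    ... | true  rewrite eq = refl
    ... | false rewrite eq = refl
    event-kind (second t)   with b t in eq
    ... | true  rewrite eq = refl
    ... | false rewrite eq = refl
    event-kind (relayIn t)  = refl
    event-kind (relayOut t) = refl
    event-kind (sink t)     = refl

    kind-index-injective : ∀ {u v} → kind u ≡ kind v → index u ≡ index v → u ≡ v
    kind-index-injective {u} {v} ke ie =
      trans (sym (event-kind u)) (trans (cong₂ event ke ie) (event-kind v))

    -- The direction and the process are projections that do not inspect b, so that they agree
    -- definitionally between the MSCs of different words.
    lab : Event → Act 3
    lab v = act (direction v) (process v) (other (action (kind v))) (distinct′ v)
      where
      distinct′ : ∀ v → process v ≢ other (action (kind v))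
      distinct′ (recv t) ()
      distinct′ (first t) with b t
      ... | true  = λ ()
      ... | false = λ ()
      distinct′ (second t) with b t
      ... | true  = λ ()
      ... | false = λ ()
      distinct′ (relayIn t) ()
      distinct′ (relayOut t) ()
      distinct′ (sink t) ()

    lab-action : ∀ v → lab v ≡ action (kind v)
    lab-action (recv t)     = refl
    lab-action (first t)    with b t
    ... | true  = refl
    ... | false = refl
    lab-action (second t)   with b t
    ... | true  = refl
    ... | false = refl
    lab-action (relayIn t)  = refl
    lab-action (relayOut t) = refl
    lab-action (sink t)     = refl

    kind≡⇒lab≡ : ∀ {u v} → kind u ≡ kind v → lab u ≡ lab v
    kind≡⇒lab≡ {u} {v} eq = trans (lab-action u) (trans (cong action eq) (sym (lab-action v)))

    lab≡⇒kind≡ : ∀ {u v} → lab u ≡ lab v → kind u ≡ kind v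
    lab≡⇒kind≡ {u} {v} eq = action-injective (trans (sym (lab-action u)) (trans eq (lab-action v)))

    kind≡⇒process≡ : ∀ {u v} → kind u ≡ kind v → process u ≡ process v
    kind≡⇒process≡ {u} {v} eq = cong me (kind≡⇒lab≡ {u} {v} eq)

    -- The other end of a message: channels are FIFO, so it carries the dual kind and the same
    -- index.
    partner : Event → Event
    partner v = event (dualKind (kind v)) (index v)

    index-partner : ∀ v → index (partner v) ≡ index v
    index-partner v = index-event (dualKind (kind v)) (index v)

    lab-partner : ∀ v → lab (partner v) ≡ dual (lab v)
    lab-partner v = begin
      lab (partner v)                ≡⟨ lab-action (partner v) ⟩
      action (kind (partner v))      ≡⟨ cong action (kind-event _ (index v)) ⟩
      action (dualKind (kind v))     ≡⟨ action-dual (kind v) ⟩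
      dual (action (kind v))         ≡⟨ cong dual (lab-action v) ⟨
      dual (lab v)                   ∎
      where open ≡-Reasoning

    partner-involutive : ∀ v → partner (partner v) ≡ v
    partner-involutive v = trans
      (cong₂ event (trans (cong dualKind (kind-event _ (index v))) (dualKind-involutive (kind v)))
                   (index-partner v))
      (event-kind v)

    -- Causal order of the spiral

    Match : Event → Event → Set
    Match u v = direction u ≡ snd × v ≡ partner u

    -- An explicit form of `Step`. The definition of `Msg` counts events below a node and so
    -- presupposes the order; generating the order from `Edge` avoids this circularity.
    Edge : Event → Event → Set
    Edge u v = v ≡ succ u ⊎ Match u v

    infix 4 _≼_
    _≼_ : Event → Event → Set
    _≼_ = Star Edge

    time-partner : ∀ u → direction u ≡ snd → time u < time (partner u)
    time-partner (relayOut t) _ = ≤-refl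
    time-partner (first t)    _ with b t
    -- Positivity of the lag puts the receipt by process 1 into a later step than the send.
    ... | true  = step<⇒time< {first t} {relayIn t} (m<m+n t (>-nonZero⁻¹ n))
    ... | false = n≤1+n _
    time-partner (second t)   _ with b t
    ... | true  = ≤-refl
    ... | false = step<⇒time< {second t} {relayIn t} (m<m+n t (>-nonZero⁻¹ n))

    time-edge : ∀ {u v} → Edge u v → time u < time v
    time-edge {u} (inj₁ refl)       = time-succ u
    time-edge {u} (inj₂ (d , refl)) = time-partner u d

    ≼⇒time≤ : ∀ {u v} → u ≼ v → time u ≤ time v
    ≼⇒time≤ ε        = ≤-refl
    ≼⇒time≤ (e ◅ es) = ≤-trans (<⇒≤ (time-edge e)) (≼⇒time≤ es)

    -- Iterating `succ` from `u` increases the time and, by `succ-least`, never jumps past `v`, so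
    -- it reaches `v`. The time difference serves as fuel.
    time≤⇒≼ : ∀ {u v} → process u ≡ process v → time u ≤ time v → u ≼ v
    time≤⇒≼ {u} {v} p le = go (time v ∸ time u) u p le ≤-refl
      where
      go : ∀ fuel u → process u ≡ process v → time u ≤ time v → time v ∸ time u ≤ fuel → u ≼ v
      go fuel u p le f with m≤n⇒m<n∨m≡n le
      ... | inj₂ eq = subst (u ≼_) (time-injective eq) ε
      go zero u p le f | inj₁ lt = contradiction (m<n⇒0<n∸m lt) (≤⇒≯ f)
      go (suc fuel) u p le f | inj₁ lt =
        inj₁ refl ◅ go fuel (succ u) (trans (process-succ u) p) (succ-least u v p lt)
          (≤-trans (∸-monoʳ-≤ (time v) (time-succ u))
            (≤-trans (≤-reflexive (sym (pred[m∸n]≡m∸[1+n] (time v) (time u)))) (pred-mono-≤ f)))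

    open Struct Event _≼_ lab using (Proc; Msg; Step; HasSize)

    <⇒time< : ∀ {u v} → u ≼ v × u ≢ v → time u < time v
    <⇒time< (le , ne) = ≤∧≢⇒< (≼⇒time≤ le) (ne ∘ time-injective)

    time<⇒< : ∀ {u v} → process u ≡ process v → time u < time v → u ≼ v × u ≢ v
    time<⇒< p lt = time≤⇒≼ p (<⇒≤ lt) , λ { refl → <-irrefl refl lt }

    Proc-succ : ∀ u → Proc u (succ u)
    Proc-succ u = record
      { sameP     = sym (process-succ u)
      ; lt        = time<⇒< (sym (process-succ u)) (time-succ u)
      ; noBetween = λ w p (l , r) →
          <⇒≱ (<⇒time< r) (succ-least u w (sym p) (<⇒time< l))
      }

    Proc⇒succ : ∀ {u v} → Proc u v → v ≡ succ u
    Proc⇒succ {u} {v} h with m≤n⇒m<n∨m≡n (succ-least u v (Proc.sameP h) (<⇒time< (Proc.lt h)))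
    ... | inj₂ eq = sym (time-injective eq)
    ... | inj₁ lt = contradiction
      ( time<⇒< (sym (process-succ u)) (time-succ u)
      , time<⇒< (trans (process-succ u) (Proc.sameP h)) lt)
      (Proc.noBetween h (succ u) (process-succ u))

    -- Within one kind the step is the index plus a constant, which is `n` for receipts of process 1
    -- from process 0 and zero otherwise.
    kind-step-mono : ∀ {u v} → kind u ≡ kind v → index u < index v → step u < step v
    kind-step-mono {u} {v} ke lt = subst₂ _<_ (step-kind u) (step-kind v)
      (subst (λ k → stepOf (kind u) (index u) < stepOf k (index v)) ke (mono (kind u) lt))
      where
      stepOf : Kind → ℕ → ℕ
      stepOf (arrive true) t = t + n
      stepOf _             t = t
      step-kind : ∀ v → stepOf (kind v) (index v) ≡ step v
      step-kind (recv t)     = refl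
      step-kind (first t)    = refl
      step-kind (second t)   = refl
      step-kind (relayIn t)  = refl
      step-kind (relayOut t) = refl
      step-kind (sink t)     = refl
      mono : ∀ k {s t} → s < t → stepOf k s < stepOf k t
      mono (out x)        lt = lt
      mono (arrive true)  lt = +-monoˡ-< n lt
      mono (arrive false) lt = lt
      mono back           lt = lt
      mono feedback       lt = lt

    kind-index<⇒time< : ∀ {u v} → kind u ≡ kind v → index u < index v → time u < time v
    kind-index<⇒time< {u} {v} ke lt = step<⇒time< {u} {v} (kind-step-mono ke lt)

    index≤⇒≼ : ∀ {u v} → kind u ≡ kind v → index u ≤ index v → u ≼ v
    index≤⇒≼ {u} {v} ke le with m≤n⇒m<n∨m≡n le
    ... | inj₁ lt = time≤⇒≼ (kind≡⇒process≡ ke) (<⇒≤ (kind-index<⇒time< ke lt))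
    ... | inj₂ eq = subst (u ≼_) (kind-index-injective ke eq) ε

    ≼⇒index≤ : ∀ {u v} → kind u ≡ kind v → u ≼ v → index u ≤ index v
    ≼⇒index≤ {u} {v} ke le with index u ≤? index v
    ... | yes p = p
    ... | no ¬p = contradiction (≼⇒time≤ le) (<⇒≱ (kind-index<⇒time< (sym ke) (≰⇒> ¬p)))

    -- The events below `u` with its label are those of its kind with indices from 0 to `index u`,
    -- whence the successor.
    past-size : ∀ u → HasSize (λ w → w ≼ u × lab w ≡ lab u) (suc (index u))
    past-size u = f , f-injective , λ w → to w , from w
      where
      f : Fin (suc (index u)) → Event
      f i = event (kind u) (toℕ i)
      f-injective : Injective _≡_ _≡_ f
      f-injective {i} {j} eq = toℕ-injective (begin
        toℕ i                              ≡⟨ index-event (kind u) (toℕ i) ⟨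
        index (f i)                        ≡⟨ cong index eq ⟩
        index (f j)                        ≡⟨ index-event (kind u) (toℕ j) ⟩
        toℕ j                              ∎)
        where open ≡-Reasoning
      to : ∀ w → w ≼ u × lab w ≡ lab u → ∃[ i ] f i ≡ w
      to w (le , eq) = fromℕ< i< ,
        trans (cong₂ event (sym ke) (toℕ-fromℕ< i<)) (event-kind w)
        where
        ke = lab≡⇒kind≡ {w} {u} eq
        i< = s≤s (≼⇒index≤ ke le)
      from : ∀ w → ∃[ i ] f i ≡ w → w ≼ u × lab w ≡ lab u
      from w (i , refl) = index≤⇒≼ ke i≤ , kind≡⇒lab≡ {f i} {u} ke
        where
        ke = kind-event (kind u) (toℕ i)
        i≤ = ≤-trans (≤-reflexive (index-event (kind u) (toℕ i))) (≤-pred (toℕ<n i))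

    -- Equal counts mean equal indices by `past-size`, and the labels are dual, so both coordinates
    -- of `v` are those of `partner u`.
    Msg⇒Match : ∀ {u v} → Msg u v → Match u v
    Msg⇒Match {u} {v} (du , dv , m , o , k , su , sv) = du ,
      kind-index-injective
        (lab≡⇒kind≡ {v} {partner u} (trans (matching-dual du dv m o) (sym (lab-partner u))))
        (trans (suc-injective (trans (HasSize-unique _≼_ lab (past-size v) sv)
                                     (HasSize-unique _≼_ lab su (past-size u))))
               (sym (index-partner u)))

    Match⇒Msg : ∀ {u v} → Match u v → Msg u v
    Match⇒Msg {u} (du , refl) =
      du ,
      trans (cong dir lp) (dual-receives (lab u) du) ,
      sym (trans (cong other lp) (dual-other (lab u))) ,
      sym (trans (cong me lp) (dual-me (lab u))) ,
      suc (index u) , past-size u ,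
      subst (HasSize _) (cong suc (index-partner u)) (past-size (partner u))
      where lp = lab-partner u

    Step⇒≼ : ∀ {u v} → Step u v → u ≼ v
    Step⇒≼ (inj₁ p) = proj₁ (Proc.lt p)
    Step⇒≼ (inj₂ m) = inj₂ (Msg⇒Match m) ◅ ε

    Edge⇒Step : ∀ {u v} → Edge u v → Step u v
    Edge⇒Step {u} (inj₁ refl) = inj₁ (Proc-succ u)
    Edge⇒Step     (inj₂ m)    = inj₂ (Match⇒Msg m)

    ≼-isPartialOrder : IsPartialOrder _≡_ _≼_
    ≼-isPartialOrder = record
      { isPreorder = record
        { isEquivalence = isEquivalence
        ; reflexive     = λ { refl → ε }
        ; trans         = _◅◅_
        }
      ; antisym = λ l r → time-injective (≤-antisym (≼⇒time≤ l) (≼⇒time≤ r))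
      }

    -- The involution `partner` exchanges the events labelled `a` with those labelled `dual a`.
    balanced : ∀ a → (Σ Event λ v → lab v ≡ a) ↔ (Σ Event λ v → lab v ≡ dual a)
    balanced a = mk↔ₛ′
      (λ { (v , eq) → partner v , trans (lab-partner v) (cong dual eq) })
      (λ { (v , eq) → partner v ,
             trans (lab-partner v) (trans (cong dual eq) (dual-involutive a)) })
      (λ { (v , _) → Σ-≡ (partner-involutive v) })
      (λ { (v , _) → Σ-≡ (partner-involutive v) })
      where
      Σ-≡ : ∀ {c v v′} {e : lab v ≡ c} {e′ : lab v′ ≡ c} → v ≡ v′ →
            _≡_ {A = Σ Event λ v → lab v ≡ c} (v , e) (v′ , e′)
      Σ-≡ {e = refl} {refl} refl = refl

    spiral : MSC 3
    spiral = record
      { V           = Event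
      ; _≤_         = _≼_
      ; lab         = lab
      ; isPO        = ≼-isPartialOrder
      ; ≤-generated = λ u v → gmap (λ v → v) Edge⇒Step , concat ∘ gmap (λ v → v) Step⇒≼
      ; downFinite  = λ v → eventsUpTo (time v) ,
          λ u le → ∈-eventsUpTo u (≤-trans (index≤time u) (≼⇒time≤ le))
      ; procLinear  = λ u v p → case ≤-total (time u) (time v) of λ
          { (inj₁ le) → inj₁ (time≤⇒≼ p le)
          ; (inj₂ le) → inj₂ (time≤⇒≼ (sym p) le)
          }
      ; balanced    = λ a _ → balanced a
      }

-- The IPDL formula

-- One round trip from `recv t`: the test selects whichever of `first t` and `second t` goes to
-- process 1, and the path continues through `relayIn t` and `relayOut (t + n)` to `recv (t + n)`.
relay : Path 3
relay = (proc ⊕ (proc ⨾ proc)) ⨾ (test (atom (action (out true))) ⨾ (msg ⨾ (proc ⨾ msg)))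

relayShifted : Path 3
relayShifted = relay ⨾ (proc ⨾ (proc ⨾ proc))

firstIs : Bool → Form 3
firstIs x = ⟨ proc ⟩ atom (action (out x))

-- On the spiral of b with lag n: if b t is 1, then b is not 0 at any t + k n = t + k′ (n + 1).
noDrop : Form 3
noDrop = neg (atom (action feedback))
       ∨ (neg (firstIs true) ∨ neg (⟨ relay ⋆ ∩ relayShifted ⋆ ⟩ firstIs false))

-- Meaning of the formula on spirals

module Satisfaction (n : ℕ) .{{_ : NonZero n}} (b : ℕ → Bool) where
  open Spiral n
  open Word b
  open Semantics spiral

  firstIs⁺ : ∀ x t → b t ≡ x → Sat (firstIs x) (recv t)
  firstIs⁺ x t eq = first t , Proc-succ (recv t) , trans (lab-action (first t)) (cong (action ∘ out) eq)

  firstIs⁻ : ∀ x t → Sat (firstIs x) (recv t) → b t ≡ x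
  firstIs⁻ x t (v , p , eq) with Proc⇒succ p
  ... | refl = out-injective (action-injective (trans (sym (lab-action (first t))) eq))
    where
    out-injective : ∀ {x y} → out x ≡ out y → x ≡ y
    out-injective refl = refl

  -- Both candidates for the tested event have index `t`, and the test fixes the kind. This
  -- determines the message to process 1, and the remaining path is functional.
  relay⁻ : ∀ {t w} → Rel relay (recv t) w → w ≡ recv (t + n)
  relay⁻ {t} (v , near , _ , (refl , isOut) , x , m , y , p , m′) = trans (proj₂ (Msg⇒Match m′))
    (cong partner (trans (Proc⇒succ p)
      (cong succ (trans (proj₂ (Msg⇒Match m)) (cong₂ event (cong dualKind out≡) index≡)))))
    where
    out≡ : kind v ≡ out true
    out≡ = action-injective (trans (sym (lab-action v)) isOut)
    index≡ : index v ≡ t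
    index≡ = case near of λ
      { (inj₁ p)            → cong index (Proc⇒succ p)
      ; (inj₂ (_ , p , p′)) → cong index (trans (Proc⇒succ p′) (cong succ (Proc⇒succ p)))
      }

  relay⁺ : ∀ t → Rel relay (recv t) (recv (t + n))
  relay⁺ t = event (out true) t , near , _ , (refl , isOut) ,
    relayIn t , Match⇒Msg (direction-out , sym partner≡) ,
    relayOut (t + n) , Proc-succ (relayIn t) , Match⇒Msg (refl , refl)
    where
    isOut : lab (event (out true) t) ≡ action (out true)
    isOut = trans (lab-action (event (out true) t)) (cong action (kind-event (out true) t))
    direction-out : direction (event (out true) t) ≡ snd
    direction-out = cong dir isOut
    partner≡ : partner (event (out true) t) ≡ relayIn t
    partner≡ = cong₂ event (cong dualKind (kind-event (out true) t)) (index-event (out true) t)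
    near : Rel (proc ⊕ (proc ⨾ proc)) (recv t) (event (out true) t)
    near with b t
    ... | true  = inj₁ (Proc-succ (recv t))
    ... | false = inj₂ (first t , Proc-succ (recv t) , Proc-succ (first t))

  relayShifted⁻ : ∀ {t w} → Rel relayShifted (recv t) w → w ≡ recv (suc (t + n))
  relayShifted⁻ (v , r , x , p , y , p′ , p″) with relay⁻ r
  ... | refl = trans (Proc⇒succ p″) (cong succ (trans (Proc⇒succ p′) (cong succ (Proc⇒succ p))))

  relayShifted⁺ : ∀ t → Rel relayShifted (recv t) (recv (suc (t + n)))
  relayShifted⁺ t = _ , relay⁺ t , _ , Proc-succ (recv (t + n)) ,
    _ , Proc-succ (first (t + n)) , Proc-succ (second (t + n))

  Star-translate⁻ : ∀ {π d} → (∀ {t w} → Rel π (recv t) w → w ≡ recv (t + d)) →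
                    ∀ {t w} → Star (Rel π) (recv t) w → ∃[ k ] w ≡ recv (t + k * d)
  Star-translate⁻ step⁻ {t} ε = 0 , cong recv (sym (+-identityʳ t))
  Star-translate⁻ {d = d} step⁻ {t} (r ◅ rs) with refl ← step⁻ r with Star-translate⁻ step⁻ rs
  ... | k , refl = suc k , cong recv (+-assoc t d (k * d))

  Star-translate⁺ : ∀ {π d} → (∀ t → Rel π (recv t) (recv (t + d))) →
                    ∀ k t → Star (Rel π) (recv t) (recv (t + k * d))
  Star-translate⁺ {π} step⁺ zero t = subst (Star (Rel π) (recv t) ∘ recv) (sym (+-identityʳ t)) ε
  Star-translate⁺ {π} {d} step⁺ (suc k) t = step⁺ t ◅
    subst (Star (Rel π) (recv (t + d)) ∘ recv) (+-assoc t d (k * d)) (Star-translate⁺ {π} step⁺ k (t + d))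

  -- The number `n` divides `k′ * n + k′ = k * n` and also `k′ * n`, hence the difference `k′`. Thus
  -- common endpoints of the two iterations lie at multiples of `n * suc n`.
  n∣k′ : ∀ k k′ → k * n ≡ k′ * suc n → n ∣ k′
  n∣k′ k k′ e = ∣m+n∣m⇒∣n (divides k k′n+k′≡kn) (n∣m*n k′)
    where
    k′n+k′≡kn : k′ * n + k′ ≡ k * n
    k′n+k′≡kn = trans (+-comm (k′ * n) k′) (trans (sym (*-suc k′ n)) (sym e))

  intersection⁻ : ∀ {t w} → Rel (relay ⋆) (recv t) w → Rel (relayShifted ⋆) (recv t) w →
                  ∃[ j ] w ≡ recv (t + j * (n * suc n))
  intersection⁻ {t} r s
    with k , refl ← Star-translate⁻ {relay} relay⁻ r
    with k′ , eq ← Star-translate⁻ {relayShifted} {suc n}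
                     (λ {t} r → trans (relayShifted⁻ r) (cong recv (sym (+-suc t n)))) s
    with divides j refl ← n∣k′ k k′ (+-cancelˡ-≡ t (k * n) (k′ * suc n) (cong index eq))
    = j , trans eq (cong (λ d → recv (t + d)) (*-assoc j n (suc n)))

  -- The distance `n * suc n` is covered by `suc n` plain round trips and by `n` shifted ones.
  intersection⁺ : ∀ t → Rel (relay ⋆) (recv t) (recv (t + n * suc n))
                      × Rel (relayShifted ⋆) (recv t) (recv (t + n * suc n))
  intersection⁺ t =
    subst (Star (Rel relay) (recv t) ∘ recv) (cong (t +_) (*-comm (suc n) n))
      (Star-translate⁺ {relay} relay⁺ (suc n) t) ,
    Star-translate⁺ {relayShifted}
      (λ t → subst (Rel relayShifted (recv t) ∘ recv) (sym (+-suc t n)) (relayShifted⁺ t)) n t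

  periodic⇒Models : (∀ t j → b (t + j * (n * suc n)) ≡ b t) → Models noDrop
  periodic⇒Models periodic (recv t) with b t in eq
  ... | false = inj₂ (inj₁ λ one → case trans (sym (firstIs⁻ true t one)) eq of λ ())
  ... | true  = inj₂ (inj₂ λ { (w , r , s , zero′) → drop r s zero′ })
    where
    drop : ∀ {w} → Rel (relay ⋆) (recv t) w → Rel (relayShifted ⋆) (recv t) w → ¬ Sat (firstIs false) w
    drop r s zero′ with j , refl ← intersection⁻ r s =
      case trans (sym eq) (trans (sym (periodic t j)) (firstIs⁻ false _ zero′)) of λ ()
  periodic⇒Models _ (first _)    = inj₁ λ ()
  periodic⇒Models _ (second _)   = inj₁ λ ()
  periodic⇒Models _ (relayIn _)  = inj₁ λ ()
  periodic⇒Models _ (relayOut _) = inj₁ λ ()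
  periodic⇒Models _ (sink _)     = inj₁ λ ()

  drop⇒¬Models : ∀ t → b t ≡ true → b (t + n * suc n) ≡ false → ¬ Models noDrop
  drop⇒¬Models t one zero′ sat with sat (recv t)
  ... | inj₁ ¬r        = ¬r refl
  ... | inj₂ (inj₁ ¬1) = ¬1 (firstIs⁺ true t one)
  ... | inj₂ (inj₂ ¬i) = ¬i (recv (t + n * suc n) , proj₁ (intersection⁺ t) , proj₂ (intersection⁺ t) ,
                             firstIs⁺ false (t + n * suc n) zero′)

-- Transfer between the spirals of two words

module Transfer (n : ℕ) .{{_ : NonZero n}} (b b′ : ℕ → Bool) where
  open Spiral n
  private
    module W  = Word b
    module W′ = Word b′
    module M  = MSC W.spiral
    module M′ = MSC W′.spiral

  -- Only the sends of process 0 have a kind that depends on the word, and for these the letter read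
  -- is the one at their step.
  kind-cong : ∀ v → (direction v ≡ snd → b (step v) ≡ b′ (step v)) → W.kind v ≡ W′.kind v
  kind-cong (first t)    e = cong out (e refl)
  kind-cong (second t)   e = cong (out ∘ not) (e refl)
  kind-cong (recv _)     e = refl
  kind-cong (relayIn _)  e = refl
  kind-cong (relayOut _) e = refl
  kind-cong (sink _)     e = refl

  lab-cong : ∀ {v} → W.kind v ≡ W′.kind v → W.lab v ≡ W′.lab v
  lab-cong {v} e = trans (W.lab-action v) (trans (cong action e) (sym (W′.lab-action v)))

  Msg-cong : ∀ {u v} → W.kind u ≡ W′.kind u → M.Msg u v → M′.Msg u v
  Msg-cong {u} e m with d , refl ← W.Msg⇒Match m = W′.Match⇒Msg (d , partner-cong u d e)
    where
    arrival : ∀ x t → W.event (arrive x) t ≡ W′.event (arrive x) t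
    arrival true  t = refl
    arrival false t = refl
    partner-cong : ∀ u → direction u ≡ snd → W.kind u ≡ W′.kind u → W.partner u ≡ W′.partner u
    partner-cong (first t)    _ e = trans (cong (λ k → W.event (dualKind k) t) e) (arrival (b′ t) t)
    partner-cong (second t)   _ e = trans (cong (λ k → W.event (dualKind k) t) e) (arrival (not (b′ t)) t)
    partner-cong (relayOut t) _ _ = refl

  -- On a single process the causal order is the order of `time`, which does not mention the word.
  ≼-cong : ∀ {u v} → process u ≡ process v → u W.≼ v → u W′.≼ v
  ≼-cong p = W′.time≤⇒≼ p ∘ W.≼⇒time≤

  <-cong : ∀ {u v} → process u ≡ process v → u M.< v → u M′.< v
  <-cong p (le , ne) = ≼-cong p le , ne

  Proc-cong : ∀ {u v} → M.Proc u v → M′.Proc u v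
  Proc-cong {u} h with refl ← W.Proc⇒succ h = W′.Proc-succ u

-- Splicing two words and their runs

splice : ℕ → (ℕ → Bool) → (ℕ → Bool) → ℕ → Bool
splice N b₁ b₂ t with t <? N
... | yes _ = b₁ t
... | no  _ = b₂ t

splice-< : ∀ {N} b₁ b₂ {t} → t < N → splice N b₁ b₂ t ≡ b₁ t
splice-< {N} b₁ b₂ {t} lt with t <? N
... | yes _ = refl
... | no ¬p = contradiction lt ¬p

splice-≥ : ∀ {N} b₁ b₂ {t} → N ≤ t → splice N b₁ b₂ t ≡ b₂ t
splice-≥ {N} b₁ b₂ {t} le with t <? N
... | yes p = contradiction le (<⇒≱ p)
... | no _  = refl

module Surgery (A : CFM 3) (n N : ℕ) .{{_ : NonZero n}} .{{_ : NonZero N}} (b₁ b₂ : ℕ → Bool)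
  (r₁ : Runs.Run A (Spiral.Word.spiral n b₁)) (r₂ : Runs.Run A (Spiral.Word.spiral n b₂)) where

  open CFM A using (nMsg; nSt)
  open Spiral n
  private
    c = pred N
    b = splice N b₁ b₂
    module W  = Word b
    module W₁ = Word b₁
    module W₂ = Word b₂
    module M  = MSC W.spiral
    module R₁ = Runs.Run r₁
    module R₂ = Runs.Run r₂
    module To₁   = Transfer n b b₁
    module To₂   = Transfer n b b₂
    module From₁ = Transfer n b₁ b
    module From₂ = Transfer n b₂ b

    State : Fin 3 → Set
    State p = Fin (nSt p)

  -- What crosses the cut between the steps N - 1 and N.
  record Agree : Set where
    field
      second≡   : R₁.ρ (second c) ≡ R₂.ρ (second c)
      relayOut≡ : R₁.ρ (relayOut c) ≡ R₂.ρ (relayOut c)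
      sink≡     : R₁.ρ (sink c) ≡ R₂.ρ (sink c)
      pending≡  : ∀ {t} → t < N → N ≤ t + n → R₁.μ (relayIn t) ≡ R₂.μ (relayIn t)

  transition-cong : ∀ {p s s′ a a′ m m′ q q′} → s ≡ s′ → a ≡ a′ → m ≡ m′ → q ≡ q′ →
                    CFM.trans A p s a m q → CFM.trans A p s′ a′ m′ q′
  transition-cong refl refl refl refl tr = tr

  module _ (agree : Agree) where
    open Agree agree

    ρ : ∀ v → State (process v)
    ρ v with step v <? N
    ... | yes _ = R₁.ρ v
    ... | no  _ = R₂.ρ v

    μ : Event → Fin nMsg
    μ v with step v <? N
    ... | yes _ = R₁.μ v
    ... | no  _ = R₂.μ v

    kind-early : ∀ {v} → step v < N → W.kind v ≡ W₁.kind v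
    kind-early {v} lt = To₁.kind-cong v λ _ → splice-< b₁ b₂ lt

    kind-late : ∀ {v} → ¬ step v < N → W.kind v ≡ W₂.kind v
    kind-late {v} ¬lt = To₂.kind-cong v λ _ → splice-≥ b₁ b₂ (≮⇒≥ ¬lt)

    lab-early : ∀ {v} → step v < N → W₁.lab v ≡ W.lab v
    lab-early {v} lt = sym (To₁.lab-cong {v} (kind-early lt))

    lab-late : ∀ {v} → ¬ step v < N → W₂.lab v ≡ W.lab v
    lab-late {v} ¬lt = sym (To₂.lab-cong {v} (kind-late ¬lt))

    ρ-late : ∀ {v} → ¬ step v < N → ρ v ≡ R₂.ρ v
    ρ-late {v} ¬lt with step v <? N
    ... | yes p = contradiction p ¬lt
    ... | no _  = refl

    -- Messages to process 2 and answers of process 1 are received in the step of their send, so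
    -- only messages to process 1 cross the cut, and `pending≡` covers those.
    crossing-message : ∀ {u v} → M.Msg u v → step u < N → ¬ step v < N → R₁.μ v ≡ R₂.μ v
    crossing-message {u} m lt ¬lt with W.Msg⇒Match m
    ... | d , refl = go u d lt ¬lt
      where
      arrival : ∀ x t → t < N → ¬ step (W.event (arrive x) t) < N →
                R₁.μ (W.event (arrive x) t) ≡ R₂.μ (W.event (arrive x) t)
      arrival true  t lt ¬lt = pending≡ lt (≮⇒≥ ¬lt)
      arrival false t lt ¬lt = contradiction lt ¬lt
      go : ∀ u → direction u ≡ snd → step u < N → ¬ step (W.partner u) < N →
           R₁.μ (W.partner u) ≡ R₂.μ (W.partner u)
      go (first t)    _ = arrival (b t) t
      go (second t)   _ = arrival (not (b t)) t
      go (relayOut t) _ lt ¬lt = contradiction lt ¬lt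

    step-succ-relayOut : ∀ t → step (succ (relayOut t)) ≡ suc t
    step-succ-relayOut t with n ≤? suc t
    ... | yes n≤ = m∸n+n≡m n≤
    ... | no _   = refl

    -- Only `second`, `sink` and `relayOut` have a successor in another step, namely the next one. A
    -- crossing therefore starts at step `N - 1`, where `Agree` applies.
    crossing-state : ∀ u → step u < N → ¬ step (succ u) < N → R₁.ρ u ≡ R₂.ρ u
    crossing-state (recv t)     lt ¬lt = contradiction lt ¬lt
    crossing-state (first t)    lt ¬lt = contradiction lt ¬lt
    crossing-state (relayIn t)  lt ¬lt = contradiction lt ¬lt
    crossing-state (second t)   lt ¬lt with refl ← ≤-antisym (<⇒≤pred lt) (pred-mono-≤ (≮⇒≥ ¬lt)) = second≡
    crossing-state (sink t)     lt ¬lt with refl ← ≤-antisym (<⇒≤pred lt) (pred-mono-≤ (≮⇒≥ ¬lt)) = sink≡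
    crossing-state (relayOut t) lt ¬lt
      with refl ← ≤-antisym (<⇒≤pred lt) (pred-mono-≤ (subst (N ≤_) (step-succ-relayOut t) (≮⇒≥ ¬lt))) = relayOut≡

    msgOk : ∀ u v → M.Msg u v → μ u ≡ μ v
    msgOk u v m with step u <? N | step v <? N
    ... | yes eu | yes ev = R₁.msgOk u v (To₁.Msg-cong (kind-early eu) m)
    ... | no lu  | no lv  = R₂.msgOk u v (To₂.Msg-cong (kind-late lu) m)
    ... | yes eu | no lv  = trans (R₁.msgOk u v (To₁.Msg-cong (kind-early eu) m))
                                  (crossing-message m eu lv)
    ... | no lu  | yes ev = contradiction
      (≤-<-trans (time≤⇒step≤ {u} {v} (W.≼⇒time≤ (W.Step⇒≼ (inj₂ m)))) ev) lu

    initOk : ∀ v → (∀ u → process u ≡ process v → ¬ (u M.< v)) →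
             CFM.trans A (process v) (CFM.init A (process v)) (W.lab v) (μ v) (ρ v)
    initOk v minimal with step v <? N
    ... | yes ev = transition-cong refl (lab-early ev) refl refl
                     (R₁.initOk v λ u p → minimal u p ∘ From₁.<-cong p)
    ... | no lv  = transition-cong refl (lab-late lv) refl refl
                     (R₂.initOk v λ u p → minimal u p ∘ From₂.<-cong p)

    stepOk : ∀ u v (h : M.Proc u v) → CFM.trans A (process v)
               (subst State (M.Proc.sameP h) (ρ u)) (W.lab v) (μ v) (ρ v)
    stepOk u v h with step u <? N | step v <? N
    ... | yes eu | yes ev = transition-cong
      (subst-irrelevant State _ (M.Proc.sameP h) refl)
      (lab-early ev) refl refl (R₁.stepOk u v (To₁.Proc-cong h))
    ... | no lu  | no lv  = transition-cong
      (subst-irrelevant State _ (M.Proc.sameP h) refl)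
      (lab-late lv) refl refl (R₂.stepOk u v (To₂.Proc-cong h))
    -- The transition is that of the second run, whose source state is replaced by the equal state
    -- of the first run at the cut.
    ... | yes eu | no lv  = transition-cong
      (subst-irrelevant State _ (M.Proc.sameP h)
        (sym (crossing-state u eu (subst (λ w → ¬ step w < N) (W.Proc⇒succ h) lv))))
      (lab-late lv) refl refl (R₂.stepOk u v (To₂.Proc-cong h))
    ... | no lu  | yes ev = contradiction
      (≤-<-trans (time≤⇒step≤ {u} {v} (W.≼⇒time≤ (W.Step⇒≼ (inj₁ h)))) ev) lu

    run : Runs.Run A W.spiral
    run = record { ρ = ρ ; μ = μ ; msgOk = msgOk ; initOk = initOk ; stepOk = stepOk }

    -- Moves an event past the cut within its process, to a position from which the spliced run
    -- follows the second run forever.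
    delay : Event → Event
    delay (recv t)     = recv (t + N)
    delay (first t)    = first (t + N)
    delay (second t)   = second (t + N)
    delay (relayIn t)  = relayIn (t + N)
    delay (relayOut t) = relayOut (t + N)
    delay (sink t)     = sink (t + N)

    process-delay : ∀ v → process (delay v) ≡ process v
    process-delay (recv _)     = refl
    process-delay (first _)    = refl
    process-delay (second _)   = refl
    process-delay (relayIn _)  = refl
    process-delay (relayOut _) = refl
    process-delay (sink _)     = refl

    delay-late : ∀ v → N + step v ≤ step (delay v)
    delay-late (recv t)     = ≤-reflexive (+-comm N t)
    delay-late (first t)    = ≤-reflexive (+-comm N t)
    delay-late (second t)   = ≤-reflexive (+-comm N t)
    delay-late (relayOut t) = ≤-reflexive (+-comm N t)
    delay-late (sink t)     = ≤-reflexive (+-comm N t)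
    delay-late (relayIn t)  = ≤-reflexive (trans (sym (+-assoc N t n)) (cong (_+ n) (+-comm N t)))

    time-delay : ∀ v → time v ≤ time (delay v)
    time-delay v = <⇒≤ (step<⇒time< {v} {delay v}
      (<-≤-trans (m<n+m (step v) (>-nonZero⁻¹ N)) (delay-late v)))

    -- Acceptance depends on the tail only: the second run visits `s` after `delay v`, hence past
    -- the cut, where the spliced run has the same states. The order is carried from one word to the
    -- other through `time`.
    cofinal : ∀ p s → Runs.Cofinal A W₂.spiral r₂ p s → Runs.Cofinal A W.spiral run p s
    cofinal p s cof v pv with v′ , le , pv′ , eq ← cof (delay v) (trans (process-delay v) pv) =
      v′ , W.time≤⇒≼ (trans pv (sym pv′)) (≤-trans (time-delay v) (W₂.≼⇒time≤ le)) , pv′ ,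
      trans (cong (subst State pv′) (ρ-late v′-late)) eq
      where
      v′-late : ¬ step v′ < N
      v′-late = ≤⇒≯ (≤-trans (≤-trans (m≤m+n N (step v)) (delay-late v))
                             (time≤⇒step≤ {delay v} {v′} (W₂.≼⇒time≤ le)))

    splice-accepted : Runs.Accepting A W₂.spiral r₂ → Accepts A W.spiral
    splice-accepted (f , final , cof) = run , f , final , λ p → cofinal p (f p) (cof p)

-- Numerical codes for functions, words and configurations

funToFin-cong : ∀ {m n} {f g : Fin m → Fin n} → (∀ i → f i ≡ g i) → Fin.funToFin f ≡ Fin.funToFin g
funToFin-cong {zero}  eq = refl
funToFin-cong {suc m} eq = cong₂ Fin.combine (eq 0F) (funToFin-cong (eq ∘ Fin.suc))

funToFin-injective : ∀ {m n} {f g : Fin m → Fin n} → Fin.funToFin f ≡ Fin.funToFin g → ∀ i → f i ≡ g i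
funToFin-injective {f = f} {g} eq i =
  trans (sym (finToFun-funToFin f i)) (trans (cong (λ k → Fin.finToFun k i) eq) (finToFun-funToFin g i))

finToFun-separates : ∀ {m n} {i j : Fin (m ^ n)} → i ≢ j → ∃[ x ] Fin.finToFun {m} {n} i x ≢ Fin.finToFun j x
finToFun-separates {m} {n} {i} {j} i≢j =
  ¬∀⟶∃¬ n _ (λ x → Fin.finToFun {m} {n} i x ≟ᶠ Fin.finToFun j x) λ eq → i≢j
    (trans (sym (funToFin-finToFin {n} {m} i)) (trans (funToFin-cong eq) (funToFin-finToFin {n} {m} j)))

mod-periodic : ∀ t j N .{{_ : NonZero N}} → (t + j * N) mod N ≡ t mod N
mod-periodic t j N = fromℕ<-cong _ _ ([m+kn]%n≡m%n t j N) _ _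

toℕ-mod : ∀ {N} .{{_ : NonZero N}} (i : Fin N) → toℕ i mod N ≡ i
toℕ-mod {N} i = toℕ-injective (trans (toℕ-fromℕ< _) (m<n⇒m%n≡m (toℕ<n i)))

n≤2^n : ∀ n → n ≤ 2 ^ n
n≤2^n zero    = z≤n
n≤2^n (suc n) = +-mono-≤ {1} (m^n>0 2 n) (≤-trans (n≤2^n n) (m≤m+n _ 0))

encode : ∀ {p q r m n} → Fin p → Fin q → Fin r → (Fin n → Fin m) → Fin (p * (q * (r * m ^ n)))
encode x y z g = Fin.combine x (Fin.combine y (Fin.combine z (Fin.funToFin g)))

encode-injective : ∀ {p q r m n} {x x′ : Fin p} {y y′ : Fin q} {z z′ : Fin r} {g g′ : Fin n → Fin m} →
                   encode x y z g ≡ encode x′ y′ z′ g′ →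
                   x ≡ x′ × y ≡ y′ × z ≡ z′ × (∀ k → g k ≡ g′ k)
encode-injective {q = q} {r} {m} {n} {x} {x′} {y} {y′} {z} {z′} eq
  with x≡ , eq₁ ← combine-injective {n = q * (r * m ^ n)} x _ x′ _ eq
  with y≡ , eq₂ ← combine-injective {n = r * m ^ n} y _ y′ _ eq₁
  with z≡ , eq₃ ← combine-injective {n = m ^ n} z _ z′ _ eq₂ = x≡ , y≡ , z≡ , funToFin-injective eq₃

keyCount : CFM 3 → ℕ → ℕ
keyCount A n = nSt 0F * (nSt 1F * (nSt 2F * nMsg ^ n))
  where open CFM A

-- Pigeonhole argument on the configurations at the cut

module Counting (A : CFM 3) (n : ℕ) .{{_ : NonZero n}}
  (keys<words : keyCount A n < 2 ^ (n * suc n))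
  (recognizes : ∀ M → (Accepts A M → Semantics.Models M noDrop) × (Semantics.Models M noDrop → Accepts A M))
  where

  open CFM A using (nMsg; nSt)

  N : ℕ
  N = n * suc n

  instance
    N≢0 : NonZero N
    N≢0 = m*n≢0 n (suc n)

  bit : Fin 2 → Bool
  bit 0F = false
  bit 1F = true

  letter : Fin (2 ^ N) → Fin N → Fin 2
  letter = Fin.finToFun {2} {N}

  word : Fin (2 ^ N) → ℕ → Bool
  word i t = bit (letter i (t mod N))

  word-periodic : ∀ i t j → word i (t + j * N) ≡ word i t
  word-periodic i t j = cong (bit ∘ letter i) (mod-periodic t j N)

  word-toℕ : ∀ i x → word i (toℕ x) ≡ bit (letter i x)
  word-toℕ i x = cong (bit ∘ letter i) (toℕ-mod x)

  open Spiral n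
  open Word using (spiral)

  -- Unfolding these proofs would make the conversion checks below very slow.
  abstract
    accepted : ∀ i → Accepts A (spiral (word i))
    accepted i = proj₂ (recognizes _) (Satisfaction.periodic⇒Models n (word i) (word-periodic i))

  module R i = Runs.Run (proj₁ (accepted i))

  -- The messages in transit at the cut are those sent in steps `N - 1` down to `N - n`. Since
  -- `n ≤ N`, the subtraction is never truncated. The content is read off at the receiving end.
  pending : Fin (2 ^ N) → Fin n → Fin nMsg
  pending i k = R.μ i (relayIn (pred N ∸ toℕ k))

  key : Fin (2 ^ N) → Fin (keyCount A n)
  key i = encode (R.ρ i (second (pred N))) (R.ρ i (relayOut (pred N))) (R.ρ i (sink (pred N))) (pending i)

  key≡⇒Agree : ∀ i j → key i ≡ key j →
               Surgery.Agree A n N (word i) (word j) (proj₁ (accepted i)) (proj₁ (accepted j))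
  key≡⇒Agree i j eq
    with second≡ , relayOut≡ , sink≡ , messages≡ ← encode-injective {g = pending i} {pending j} eq = record
    { second≡ = second≡ ; relayOut≡ = relayOut≡ ; sink≡ = sink≡ ; pending≡ = pending≡ }
    where
    pending≡ : ∀ {t} → t < N → N ≤ t + n → R.μ i (relayIn t) ≡ R.μ j (relayIn t)
    pending≡ {t} t<N N≤t+n = subst (λ s → R.μ i (relayIn s) ≡ R.μ j (relayIn s)) position
      (messages≡ (fromℕ< k<n))
      where
      k<n : pred N ∸ t < n
      k<n = m<n+o⇒m∸n<o (pred N) t (subst (_≤ t + n) (sym (suc-pred N)) N≤t+n)
      position : pred N ∸ toℕ (fromℕ< k<n) ≡ t
      position = trans (cong (pred N ∸_) (toℕ-fromℕ< k<n)) (m∸[m∸n]≡n (<⇒≤pred t<N))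

  -- Following word `i` for one period and word `j` afterwards is accepted by surgery, so it must
  -- satisfy `noDrop`. A 1 of `i` at `x` and a 0 of `j` at `x` would be a drop at distance `N`.
  no-drop-between : ∀ i j → key i ≡ key j → ∀ x →
                    letter i x ≡ 1F → letter j x ≢ 0F
  no-drop-between i j eq x one zero′ =
    Satisfaction.drop⇒¬Models n (splice N (word i) (word j)) (toℕ x)
      (trans (splice-< (word i) (word j) (toℕ<n x)) (trans (word-toℕ i x) (cong bit one)))
      (trans (splice-≥ (word i) (word j) (m≤n+m N (toℕ x))) word-j)
      (proj₁ (recognizes _) (Surgery.splice-accepted A n N (word i) (word j) _ _
        (key≡⇒Agree i j eq) (proj₂ (accepted j))))
    where
    word-j : word j (toℕ x + N) ≡ false
    word-j = trans (cong (λ d → word j (toℕ x + d)) (sym (*-identityˡ N)))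
      (trans (word-periodic j (toℕ x) 1) (trans (word-toℕ j x) (cong bit zero′)))

  -- Two words with the same key differ at some position; the word with the 1 there is put first in
  -- the splice.
  absurd : ⊥
  absurd with i , j , i<j , eq ← pigeonhole keys<words key
         with x , ne ← finToFun-separates {2} {N} (<⇒≢ᶠ i<j)
         with letter i x in eᵢ | letter j x in eⱼ
  ... | 0F | 0F = ne refl
  ... | 0F | 1F = no-drop-between j i (sym eq) x eⱼ eᵢ
  ... | 1F | 0F = no-drop-between i j eq x eᵢ eⱼ
  ... | 1F | 1F = ne refl

-- A lag with fewer configurations than words

module Bound (A : CFM 3) where
  open CFM A using (nMsg; nSt)

  bound : ℕ
  bound = nSt 0F + (nSt 1F + (nSt 2F + nMsg))

  -- The three state counts and the `n` message factors are each at most `2 ^ bound`. The resulting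
  -- product unfolds definitionally from `(2 ^ bound) ^ (3 + n)`.
  keyCount< : ∀ n → bound * (3 + n) < n * suc n → keyCount A n < 2 ^ (n * suc n)
  keyCount< n exponent< = begin-strict
    keyCount A n                 ≤⟨ *-mono-≤ (small s₀≤) (*-mono-≤ (small s₁≤)
                                      (*-mono-≤ (small s₂≤) (^-monoˡ-≤ n (small m≤)))) ⟩
    (2 ^ bound) ^ (3 + n) ≡⟨ ^-*-assoc 2 bound (3 + n) ⟩
    2 ^ (bound * (3 + n)) <⟨ ^-monoʳ-< 2 ≤-refl exponent< ⟩
    2 ^ (n * suc n)                 ∎
    where
    open ≤-Reasoning
    small : ∀ {k} → k ≤ bound → k ≤ 2 ^ bound
    small le = ≤-trans le (n≤2^n bound)
    s₀≤ : nSt 0F ≤ bound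
    s₀≤ = m≤m+n _ _
    s₁≤ : nSt 1F ≤ bound
    s₁≤ = ≤-trans (m≤m+n _ _) (m≤n+m _ (nSt 0F))
    s₂≤ : nSt 2F ≤ bound
    s₂≤ = ≤-trans (m≤m+n _ _) (≤-trans (m≤n+m _ (nSt 1F)) (m≤n+m _ (nSt 0F)))
    m≤ : nMsg ≤ bound
    m≤ = ≤-trans (m≤n+m _ (nSt 2F)) (≤-trans (m≤n+m _ (nSt 1F)) (m≤n+m _ (nSt 0F)))

  -- With `d` for `bound`, the product `(3 + d) * (4 + d)` exceeds `d * (6 + d)` by `12 + d`.
  lag : ℕ
  lag = 3 + bound

  lag-large : bound * (3 + lag) < lag * suc lag
  lag-large = ≤-trans (s≤s (m≤m+n _ (11 + bound))) (≤-reflexive (exponents bound))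
    where
    exponents : ∀ d → suc (d * (6 + d) + (11 + d)) ≡ (3 + d) * (4 + d)
    exponents = solve-∀

theorem7p3 : Σ ℕ λ n → Σ (Form n) λ α →
    ¬ (Σ (CFM n) λ A → ∀ (M : MSC n) →
    (Accepts A M → Semantics.Models M α) × (Semantics.Models M α → Accepts A M))
theorem7p3 = 3 , noDrop , λ (A , recognizes) →
  Counting.absurd A (Bound.lag A) (Bound.keyCount< A (Bound.lag A) (Bound.lag-large A)) recognizes
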